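{- Let $P=(Q,I,M,\Delta)$ be a broadcast protocol, $F\subseteq Q$, and $S$ the set of states returned by the saturation algorithm on $P$. If $F\cap S\neq\emptyset$, then there exists a lossy execution $\rho$ covering $F$ with at most $2|Q|$ nodes and length at most $2|Q|^2$.
   Context: A broadcast protocol is a tuple $P=(Q,I,M,\Delta)$ where $Q$ is a finite set of states, $I\subseteq Q$ initial states, $M$ a finite message alphabet and $\Delta\subseteq Q\times\{!!m,\ ??m \mid m\in M\}\times Q$ ($!!m$ = broadcast, $??m$ = reception). Protocols are complete for receptions: for every $q$, $m$ there is $q'$ with $(q,??m,q')\in\Delta$. A configuration is a finite undirected graph $\gamma=(V,E,L)$, $E$ symmetric irreflexive, $L:V\to Q$; $L(\gamma)=L(V)$; $\gamma$ is initial if $L(V)\subseteq I$. A lossy step goes from $\gamma=(V,E,L)$ to $\gamma'=(V,E,L')$ (same nodes and edges) if there exist a node $v$ and $m\in M$ with $(L(v),!!m,L'(v))\in\Delta$ and either (a) $L'(v')=L(v')$ for all $v'\neq v$ (lost broadcast), or (b) for every $v'\neq v$: if $v'$ is a neighbour of $v$ then $(L(v'),??m,L'(v'))\in\Delta$, otherwise $L'(v')=L(v')$ (successful broadcast). A lossy execution is a sequence $\gamma_0,\dots,\gamma_r$ with $\gamma_0$ initial and consecutive lossy steps; its number of nodes is $|V|$, its length is $r$, and it covers $F$ if $L(\gamma_r)\cap F\neq\emptyset$. The saturation algorithm: start with $S:=I$, $c:=|I|$; repeat: if there is $(q_1,!!m,q_2)\in\Delta$ with $q_1\in S$, $q_2\notin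 S$, add $q_2$ to $S$ and $c:=c+1$; else if there are $(q_1,!!m,q_2),(q_1',??m,q_2')\in\Delta$ with $q_1,q_2,q_1'\in S$, $q_2'\notin S$, add $q_2'$ and $c:=c+2$; else stop and return $S$. -}

module Defs where

open import Data.Fin using (Fin)
open import Data.Fin.Subset using (Subset; _∈_; _∉_; _∪_; ⁅_⁆; ∣_∣)
open import Data.Nat using (ℕ; zero; suc; _+_)
open import Data.Product using (Σ; ∃; ∃-syntax; _×_; _,_; proj₁; proj₂)
open import Data.Sum using (_⊎_)
open import Level using (0ℓ)
open import Relation.Binary using (Rel; Symmetric)
import Relation.Binary as B
open import Relation.Binary.Construct.Closure.ReflexiveTransitive using (Star; fold)
open import Relation.Binary.PropositionalEquality using (_≡_; _≢_)
open import Relation.Nullary using (¬_)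
open import Relation.Unary using (Pred)
import Relation.Unary as U

data Action (M : Set) : Set where
  !!_ : M → Action M
  ??_ : M → Action M

-- The finite sets Q and M are represented by initial segments Fin ∣Q∣ and
-- Fin ∣M∣; subsets of finite sets are decidable.
record Protocol : Set₁ where
  field
    ∣Q∣ ∣M∣ : ℕ

  Q : Set
  Q = Fin ∣Q∣

  M : Set
  M = Fin ∣M∣

  field
    I        : Subset ∣Q∣
    Δ        : Pred (Q × Action M × Q) 0ℓ
    Δ?       : U.Decidable Δ
    complete : ∀ q m → ∃[ q′ ] Δ (q , ?? m , q′)

record Graph : Set₁ where
  field
    ∣V∣ : ℕ

  V : Set
  V = Fin ∣V∣

  field
    E        : Rel V 0ℓ
    E?       : B.Decidable E
    E-sym    : Symmetric E
    E-irrefl : ∀ v → ¬ E v v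

module Lossy (P : Protocol) where
  open Protocol P
  open Graph

  Configuration : Set₁
  Configuration = Σ Graph λ G → V G → Q

  Initial : Configuration → Set
  Initial (G , L) = ∀ v → L v ∈ I

  Lost : (G : Graph) → V G → (L L′ : V G → Q) → Set
  Lost G v L L′ = ∀ v′ → v′ ≢ v → L′ v′ ≡ L v′

  Successful : (G : Graph) → V G → M → (L L′ : V G → Q) → Set
  Successful G v m L L′ = ∀ v′ → v′ ≢ v →
    (E G v v′ → Δ (L v′ , ?? m , L′ v′)) × (¬ E G v v′ → L′ v′ ≡ L v′)

  data _⟶_ : Rel Configuration (Level.suc 0ℓ) where
    step : ∀ {G L L′} (v : V G) (m : M) →
           Δ (L v , !! m , L′ v) →
           Lost G v L L′ ⊎ Successful G v m L L′ →
           (G , L) ⟶ (G , L′)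

  record Execution : Set₁ where
    field
      first last : Configuration
      initial    : Initial first
      steps      : Star _⟶_ first last

    nodes : ℕ
    nodes = Graph.∣V∣ (proj₁ first)

    length : ℕ
    length = fold (λ _ _ → ℕ) (λ _ n → suc n) zero steps

  open Execution

  Covers : Execution → Subset ∣Q∣ → Set
  Covers ρ F = ∃[ v ] proj₂ (last ρ) v ∈ F

-- The algorithm may choose freely among the applicable transitions of the
-- branch it takes, so one iteration is a relation on the values of (S , c).
module Saturation (P : Protocol) where
  open Protocol P

  BroadcastAdds : Subset ∣Q∣ → Q → Set
  BroadcastAdds S q₂ = ∃[ q₁ ] ∃[ m ]
    Δ (q₁ , !! m , q₂) × q₁ ∈ S × q₂ ∉ S

  ReceptionAdds : Subset ∣Q∣ → Q → Set
  ReceptionAdds S q₂′ = ∃[ q₁ ] ∃[ m ] ∃[ q₂ ] ∃[ q₁′ ]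
    Δ (q₁ , !! m , q₂) × Δ (q₁′ , ?? m , q₂′) ×
    q₁ ∈ S × q₂ ∈ S × q₁′ ∈ S × q₂′ ∉ S

  data _↝_ : Rel (Subset ∣Q∣ × ℕ) 0ℓ where
    broadcast : ∀ {S c q} → BroadcastAdds S q →
                (S , c) ↝ (S ∪ ⁅ q ⁆ , c + 1)
    reception : ∀ {S c q} → ¬ ∃ (BroadcastAdds S) → ReceptionAdds S q →
                (S , c) ↝ (S ∪ ⁅ q ⁆ , c + 2)

  Returns : Subset ∣Q∣ → Set
  Returns S = ∃[ c ] Star _↝_ (I , ∣ I ∣) (S , c) ×
              ¬ ∃ (BroadcastAdds S) × ¬ ∃ (ReceptionAdds S)

{-# OPTIONS --safe #-}
-- Along the saturation one maintains an execution reaching all states of S at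
-- once, on pairwise non-adjacent "main" nodes.  A node can be cloned together
-- with its neighbourhood: the clone receives whatever the original receives
-- and repeats, as lost broadcasts, what the original broadcasts.  A new state
-- reached by a broadcast is obtained by one clone losing one more broadcast.
-- A new state reached by a reception is obtained by cloning the sender and the
-- receiver and joining the two clones by an edge: this edge is invisible to
-- the history, in which the clones only lose broadcasts, and the other
-- neighbours of the sender's clone are not main, so that the final broadcast
-- may spoil them.  Cloning preserves the bound ∣S∣ on the number of broadcasts
-- per node, so the length is at most ∣S∣ times the number of nodes.
module Submission where

open import Data.Bool using (if_then_else_)
open import Data.Empty using (⊥; ⊥-elim)
open import Data.Fin using (Fin; zero; suc)
open import Data.Fin.Properties using (_≟_; nonZeroIndex)
open import Data.Fin.Subset using (Subset; Nonempty; _∩_; _∪_; _∈_; _∉_; ⁅_⁆; ∣_∣; inside; outside)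
open import Data.Fin.Subset.Properties using (p⊂q⇒∣p∣<∣q∣; p⊆p∪q; q⊆p∪q; x∈⁅x⁆;
  x∈⁅y⁆⇒x≡y; x∈p∪q⁻; x∈p∩q⁻; ∣p∣≤n)
open import Data.Nat using (ℕ; suc; _+_; _*_; _^_; _≤_; z≤n; s≤s; >-nonZero⁻¹)
open import Data.Nat.Properties using (≤-refl; ≤-trans; ≤-reflexive; n≤1+n; +-mono-≤; +-monoʳ-≤;
  *-mono-≤; *-monoʳ-≤; *-suc; +-suc; *-assoc; *-identityʳ; +-identityʳ;
  m≤m+n; module ≤-Reasoning)
open import Data.Product using (Σ; ∃-syntax; _×_; _,_; proj₁; proj₂)
open import Data.Sum using (_⊎_; inj₁; inj₂; [_,_]′; map₂)
open import Data.Unit using (⊤; tt)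
open import Data.Vec using (_∷_; []; here; there)
open import Function using (_∘_)
open import Level using (0ℓ)
open import Relation.Binary.Construct.Closure.ReflexiveTransitive using (Star; ε; _◅_; fold)
open import Relation.Binary.PropositionalEquality using (_≡_; _≢_; refl; sym; trans; cong; subst)
open import Relation.Nullary using (¬_; does; yes; no; _⊎-dec_; _×-dec_)
open import Relation.Unary using (Pred; ∅)
open import Defs

-- Finite subsets.

enumerate : ∀ {n} (p : Subset n) →
            Σ (Fin ∣ p ∣ → Fin n) λ f → (∀ i → f i ∈ p) × (∀ {x} → x ∈ p → ∃[ i ] f i ≡ x)
enumerate [] = (λ ()) , (λ ()) , λ ()
enumerate (outside ∷ p) with enumerate p
... | f , f∈p , onto = suc ∘ f , there ∘ f∈p ,
                       λ { (there x∈p) → proj₁ (onto x∈p) , cong suc (proj₂ (onto x∈p)) }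
enumerate {suc n} (inside ∷ p) with enumerate p
... | f , f∈p , onto = g , g∈p , onto′
  where
  g : Fin (suc ∣ p ∣) → Fin (suc n)
  g zero    = zero
  g (suc i) = suc (f i)
  g∈p : ∀ i → g i ∈ (inside ∷ p)
  g∈p zero    = here
  g∈p (suc i) = there (f∈p i)
  onto′ : ∀ {x} → x ∈ (inside ∷ p) → ∃[ i ] g i ≡ x
  onto′ here        = zero , refl
  onto′ (there x∈p) = suc (proj₁ (onto x∈p)) , cong suc (proj₂ (onto x∈p))

∣p∣<∣p∪⁅x⁆∣ : ∀ {n} {p : Subset n} {x} → x ∉ p → suc ∣ p ∣ ≤ ∣ p ∪ ⁅ x ⁆ ∣
∣p∣<∣p∪⁅x⁆∣ {p = p} {x} x∉p =
  p⊂q⇒∣p∣<∣q∣ (p⊆p∪q ⁅ x ⁆ , x , q⊆p∪q p ⁅ x ⁆ (x∈⁅x⁆ x) , x∉p)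

-- Cloning a node of a graph and adding an edge.

open Graph

original : ∀ {n} → Fin n → Fin (suc n) → Fin n
original p zero    = p
original p (suc u) = u

-- Pulling the edges back along `original p` gives the clone the neighbours of `p`. The clone and
-- `p` are not adjacent, because `E` is irreflexive.
cloneGraph : (G : Graph) → V G → Graph
cloneGraph G p = record
  { ∣V∣      = suc (∣V∣ G)
  ; E        = λ u v → E G (π u) (π v)
  ; E?       = λ u v → E? G (π u) (π v)
  ; E-sym    = E-sym G
  ; E-irrefl = λ v → E-irrefl G (π v)
  }
  where π = original p

addEdge : (G : Graph) (x y : V G) → x ≢ y → Graph
addEdge G x y x≢y = record
  { ∣V∣      = ∣V∣ G
  ; E        = λ u v → E G u v ⊎ (u ≡ x × v ≡ y) ⊎ (u ≡ y × v ≡ x)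
  ; E?       = λ u v → E? G u v ⊎-dec ((u ≟ x) ×-dec (v ≟ y)) ⊎-dec ((u ≟ y) ×-dec (v ≟ x))
  ; E-sym    = λ { (inj₁ e) → inj₁ (E-sym G e)
                 ; (inj₂ (inj₁ (a , b))) → inj₂ (inj₂ (b , a))
                 ; (inj₂ (inj₂ (a , b))) → inj₂ (inj₁ (b , a)) }
  ; E-irrefl = λ { v (inj₁ e) → E-irrefl G v e
                 ; v (inj₂ (inj₁ (refl , b))) → x≢y b
                 ; v (inj₂ (inj₂ (refl , b))) → x≢y (sym b) }
  }

-- Runs on a fixed graph and their budgets.

module _ (P : Protocol) where
  open Protocol P
  open Lossy P
  open Saturation P

  -- Executions on a fixed graph in which the nodes of Quiet only lose broadcasts.
  data Run (G : Graph) (Quiet : Pred (V G) 0ℓ) (L₀ : V G → Q) : (V G → Q) → Set where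
    []   : Run G Quiet L₀ L₀
    snoc : ∀ {L L′} → Run G Quiet L₀ L → (v : V G) (m : M) →
           Δ (L v , !! m , L′ v) →
           Lost G v L L′ ⊎ (¬ Quiet v × Successful G v m L L′) →
           Run G Quiet L₀ L′

  module _ {G : Graph} {Quiet : Pred (V G) 0ℓ} {L₀ : V G → Q} where

    len : ∀ {L} → Run G Quiet L₀ L → ℕ
    len []               = 0
    len (snoc r _ _ _ _) = suc (len r)

    broadcasts : ∀ {L} → Run G Quiet L₀ L → V G → ℕ
    broadcasts []               u = 0
    broadcasts (snoc r v _ _ _) u =
      if does (v ≟ u) then suc (broadcasts r u) else broadcasts r u

    -- The bound per node makes the length bound survive cloning: a clone of `p` adds one node and
    -- `broadcasts r p` steps, which is at most `s`.
    Budget : ∀ {L} → ℕ → Run G Quiet L₀ L → Set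
    Budget s r = len r ≤ ∣V∣ G * s × (∀ u → broadcasts r u ≤ s)

    broadcasts-snoc : ∀ {L L′} (r : Run G Quiet L₀ L) v m d
                      (s : Lost G v L L′ ⊎ (¬ Quiet v × Successful G v m L L′)) →
                      ∀ u → broadcasts (snoc {L′ = L′} r v m d s) u ≤ suc (broadcasts r u)
    broadcasts-snoc r v m d s u with v ≟ u
    ... | yes _ = ≤-refl
    ... | no  _ = n≤1+n _

  BudgetedRun : (G : Graph) → Pred (V G) 0ℓ → ℕ → (L₀ L : V G → Q) → Set
  BudgetedRun G Quiet s L₀ L = Σ (Run G Quiet L₀ L) (Budget s)

  budget-snoc : ∀ {G Quiet s t L₀ L L′} → suc s ≤ t →
                BudgetedRun G Quiet s L₀ L → (v : V G) (m : M) →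
                Δ (L v , !! m , L′ v) →
                Lost G v L L′ ⊎ (¬ Quiet v × Successful G v m L L′) →
                BudgetedRun G Quiet t L₀ L′
  budget-snoc {G} {s = s} {t} s<t (r , len≤ , br≤) v m d how =
    snoc r v m d how , len≤′ ,
    λ u → ≤-trans (broadcasts-snoc r v m d how u) (≤-trans (s≤s (br≤ u)) s<t)
    where
    open ≤-Reasoning
    len≤′ : suc (len r) ≤ ∣V∣ G * t
    len≤′ = begin
      -- The node `v` shows that the graph is nonempty, so a larger budget per node leaves room for
      -- one more step.
      1 + len r          ≤⟨ +-mono-≤ (>-nonZero⁻¹ _ {{nonZeroIndex v}}) len≤ ⟩
      ∣V∣ G + ∣V∣ G * s  ≡⟨ *-suc (∣V∣ G) s ⟨
      ∣V∣ G * suc s      ≤⟨ *-monoʳ-≤ (∣V∣ G) s<t ⟩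
      ∣V∣ G * t          ∎

  -- Cloning a node in a run.

  QuietClone : ∀ {n} → Pred (Fin n) 0ℓ → Pred (Fin (suc n)) 0ℓ
  -- The clone broadcasts only to catch up with its original, and always loses the message.
  QuietClone Quiet zero    = ⊤
  QuietClone Quiet (suc u) = Quiet u

  module _ {G : Graph} {Quiet : Pred (V G) 0ℓ} {L₀ : V G → Q} (p : V G) where

    private π = original p

    -- By induction on the run. A broadcast by another node affects the clone exactly as it affects
    -- `p`; a broadcast by `p` becomes two steps, hence the term `broadcasts r p` in the length.
    clone : ∀ {L} (r : Run G Quiet L₀ L) →
            Σ (Run (cloneGraph G p) (QuietClone Quiet) (L₀ ∘ π) (L ∘ π)) λ r′ →
              len r′ ≡ broadcasts r p + len r ×
              (∀ u → broadcasts r′ u ≡ broadcasts r (π u))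
    clone [] = [] , refl , λ _ → refl
    clone (snoc {L} {L′} r v m d how) with clone r | v ≟ p
    ... | r′ , len≡ , br≡ | no v≢p =
      snoc r′ (suc v) m d (lift how) ,
      trans (cong suc len≡) (sym (+-suc _ _)) ,
      br≡′
      where
      π≢v : ∀ u → u ≢ suc v → π u ≢ v
      π≢v zero    _  = v≢p ∘ sym
      π≢v (suc u) ne = ne ∘ cong suc
      lift : Lost G v L L′ ⊎ (¬ Quiet v × Successful G v m L L′) →
             Lost (cloneGraph G p) (suc v) (L ∘ π) (L′ ∘ π) ⊎
             (¬ Quiet v × Successful (cloneGraph G p) (suc v) m (L ∘ π) (L′ ∘ π))
      lift (inj₁ lost)       = inj₁ λ u ne → lost (π u) (π≢v u ne)
      lift (inj₂ (nq , succ)) = inj₂ (nq , λ u ne → succ (π u) (π≢v u ne))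
      br≡′ : ∀ u → broadcasts (snoc {L′ = L′ ∘ π} r′ (suc v) m d (lift how)) u
                 ≡ broadcasts (snoc {L′ = L′} r v m d how) (π u)
      br≡′ zero with v ≟ p
      ... | yes v≡p = ⊥-elim (v≢p v≡p)
      ... | no _    = br≡ zero
      br≡′ (suc u) = cong (λ b → if does (v ≟ u) then suc b else b) (br≡ (suc u))
    ... | r′ , len≡ , br≡ | yes refl =
      -- In `mid` the original has moved and the clone has not: being non-adjacent, it does not hear
      -- the original, and can then make the same transition.
      snoc {L = mid} (snoc r′ (suc v) m d (lift how)) zero m d (inj₁ catchUp) ,
      cong suc (trans (cong suc len≡) (sym (+-suc _ _))) ,
      br≡′
      where
      mid : Fin (suc (∣V∣ G)) → Q
      mid zero    = L v
      mid (suc u) = L′ u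
      catchUp : Lost (cloneGraph G v) zero mid (L′ ∘ π)
      catchUp zero    ne = ⊥-elim (ne refl)
      catchUp (suc u) _  = refl
      lift : Lost G v L L′ ⊎ (¬ Quiet v × Successful G v m L L′) →
             Lost (cloneGraph G v) (suc v) (L ∘ π) mid ⊎
             (¬ Quiet v × Successful (cloneGraph G v) (suc v) m (L ∘ π) mid)
      lift (inj₁ lost) = inj₁ λ { zero    _  → refl
                                ; (suc u) ne → lost u (ne ∘ cong suc) }
      lift (inj₂ (nq , succ)) = inj₂ (nq , λ
        { zero    _  → ⊥-elim ∘ E-irrefl G v , λ _ → refl
        ; (suc u) ne → succ u (ne ∘ cong suc) })
      br≡′ : ∀ u → broadcasts (snoc {L′ = L′ ∘ π} (snoc {L′ = mid} r′ (suc v) m d (lift how))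
                                     zero m d (inj₁ catchUp)) u
                 ≡ broadcasts (snoc {L′ = L′} r v m d how) (π u)
      br≡′ zero with v ≟ v
      ... | yes _  = cong suc (br≡ zero)
      ... | no v≢v = ⊥-elim (v≢v refl)
      br≡′ (suc u) = cong (λ b → if does (v ≟ u) then suc b else b) (br≡ (suc u))

    budget-clone : ∀ {s L} → BudgetedRun G Quiet s L₀ L →
                   BudgetedRun (cloneGraph G p) (QuietClone Quiet) s (L₀ ∘ π) (L ∘ π)
    budget-clone (r , len≤ , br≤) with clone r
    ... | r′ , len≡ , br≡ =
      r′ , ≤-trans (≤-reflexive len≡) (+-mono-≤ (br≤ p) len≤) ,
      λ u → ≤-trans (≤-reflexive (br≡ u)) (br≤ (π u))

  -- Joining two quiet nodes by an edge.

  module _ {G : Graph} {Quiet : Pred (V G) 0ℓ} {L₀ : V G → Q}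
           {x y : V G} (x≢y : x ≢ y) (qx : Quiet x) (qy : Quiet y) where

    private G⁺ = addEdge G x y x≢y

    -- Only a successful broadcast from `x` or `y` could use the new edge, and quietness excludes
    -- it. Lost broadcasts do not look at edges. The result has no quiet nodes, so `x` may broadcast
    -- successfully afterwards.
    rewire : ∀ {L} (r : Run G Quiet L₀ L) →
             Σ (Run G⁺ ∅ L₀ L) λ r′ →
               len r′ ≡ len r × (∀ u → broadcasts r′ u ≡ broadcasts r u)
    rewire [] = [] , refl , λ _ → refl
    rewire (snoc {L} {L′} r v m d how) with rewire r
    ... | r′ , len≡ , br≡ =
      snoc r′ v m d (lift how) , cong suc len≡ ,
      λ u → cong (λ b → if does (v ≟ u) then suc b else b) (br≡ u)
      where
      lift : Lost G v L L′ ⊎ (¬ Quiet v × Successful G v m L L′) →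
             Lost G⁺ v L L′ ⊎ (¬ ∅ v × Successful G⁺ v m L L′)
      lift (inj₁ lost)        = inj₁ lost
      lift (inj₂ (nq , succ)) = inj₂ ((λ ()) , λ u ne →
        (λ { (inj₁ e)                    → proj₁ (succ u ne) e
           ; (inj₂ (inj₁ (refl , _))) → ⊥-elim (nq qx)
           ; (inj₂ (inj₂ (refl , _))) → ⊥-elim (nq qy) }) ,
        (λ ¬e → proj₂ (succ u ne) (¬e ∘ inj₁)))

    budget-rewire : ∀ {s L} → BudgetedRun G Quiet s L₀ L → BudgetedRun G⁺ ∅ s L₀ L
    budget-rewire (r , len≤ , br≤) with rewire r
    ... | r′ , len≡ , br≡ =
      r′ , ≤-trans (≤-reflexive len≡) len≤ , λ u → ≤-trans (≤-reflexive (br≡ u)) (br≤ u)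

  -- Covering all saturated states by one run.

  record Cover (S : Subset ∣Q∣) : Set₁ where
    field
      G        : Graph
      Quiet    : Pred (V G) 0ℓ
      L₀ L     : V G → Q
      initial  : Initial (G , L₀)
      run      : BudgetedRun G Quiet ∣ S ∣ L₀ L
      nodes    : ∣V∣ G ≤ 2 * ∣ S ∣
      Main     : Pred (V G) 0ℓ
      -- This keeps the main nodes out of reach when a clone of one of them broadcasts.
      nonadj   : ∀ {u v} → Main u → Main v → ¬ E G u v
      cover    : ∀ {q} → q ∈ S → ∃[ v ] Main v × L v ≡ q

  cover-I : Cover I
  cover-I with enumerate I
  ... | f , f∈I , onto = record
    -- One isolated node per initial state, all of them main.
    { G       = record { ∣V∣ = ∣ I ∣ ; E = λ _ _ → ⊥ ; E? = λ _ _ → no λ ()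
                       ; E-sym = λ () ; E-irrefl = λ _ () }
    ; Quiet   = λ _ → ⊥
    ; initial = f∈I
    ; run     = [] , z≤n , λ _ → z≤n
    ; nodes   = m≤m+n _ _
    ; Main    = λ _ → ⊤
    ; nonadj  = λ _ _ ()
    ; cover   = λ q∈I → proj₁ (onto q∈I) , tt , proj₂ (onto q∈I)
    }

  -- Each new state pays for two new nodes, the number of clones that a reception uses.
  2+n≤2*t : ∀ {n s t} → suc s ≤ t → n ≤ 2 * s → 2 + n ≤ 2 * t
  2+n≤2*t {n} {s} {t} s<t n≤ = begin
    2 + n       ≤⟨ +-monoʳ-≤ 2 n≤ ⟩
    2 + 2 * s   ≡⟨ *-suc 2 s ⟨
    2 * suc s   ≤⟨ *-monoʳ-≤ 2 s<t ⟩
    2 * t       ∎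
    where open ≤-Reasoning

  cover-broadcast : ∀ {S q} → Cover S → BroadcastAdds S q → Cover (S ∪ ⁅ q ⁆)
  cover-broadcast {S} {q} C (q₁ , m , d , q₁∈S , q∉S) with Cover.cover C q₁∈S
  ... | p , main-p , refl = record
    { G       = cloneGraph G p
    ; Quiet   = QuietClone Quiet
    ; L       = L′
    ; initial = initial ∘ original p
    ; run     = budget-snoc ∣S∣< (budget-clone p run) zero m d (inj₁ lost)
    ; nodes   = ≤-trans (n≤1+n _) (2+n≤2*t ∣S∣< nodes)
    -- Edges and main nodes are pulled back along the same map, so non-adjacency carries over.
    ; Main    = Main ∘ original p
    ; nonadj  = nonadj
    ; cover   = [ old , new ]′ ∘ x∈p∪q⁻ S ⁅ q ⁆
    }
    where
    open Cover C
    ∣S∣< = ∣p∣<∣p∪⁅x⁆∣ q∉S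
    L′ : Fin (suc (∣V∣ G)) → Q
    L′ zero    = q
    L′ (suc u) = L u
    lost : Lost (cloneGraph G p) zero (L ∘ original p) L′
    lost zero    ne = ⊥-elim (ne refl)
    lost (suc u) _  = refl
    old : ∀ {q′} → q′ ∈ S → ∃[ v ] Main (original p v) × L′ v ≡ q′
    old q′∈S = suc (proj₁ (cover q′∈S)) , proj₂ (cover q′∈S)
    new : ∀ {q′} → q′ ∈ ⁅ q ⁆ → ∃[ v ] Main (original p v) × L′ v ≡ q′
    new q′∈ = zero , main-p , sym (x∈⁅y⁆⇒x≡y q q′∈)

  cover-reception : ∀ {S q} → Cover S → ReceptionAdds S q → Cover (S ∪ ⁅ q ⁆)
  cover-reception {S} {q} C (q₁ , m , q₂ , q₁′ , d , d′ , q₁∈S , _ , q₁′∈S , q∉S)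
    with Cover.cover C q₁∈S | Cover.cover C q₁′∈S
  ... | p , main-p , refl | p′ , main-p′ , refl = record
    { G       = G₃
    -- The sender's clone ends with a successful broadcast, so it is no longer quiet; later
    -- receptions join fresh clones.
    ; Quiet   = λ _ → ⊥
    ; L       = L′
    ; initial = initial ∘ original p ∘ original (suc p′)
    ; run     = budget-snoc ∣S∣<
                  -- The sender `p` is cloned first, so its clone ends up as `suc zero` and that of
                  -- `p′` as `zero`. The two are distinct even if `p` and `p′` coincide.
                  (budget-rewire x≢y tt tt (budget-clone (suc p′) (budget-clone p run)))
                  x m d (inj₂ ((λ ()) , successful))
    ; nodes   = 2+n≤2*t ∣S∣< nodes
    ; Main    = Main′
    ; nonadj  = λ {u} {v} → nonadj′ u v
    ; cover   = [ old , new ]′ ∘ x∈p∪q⁻ S ⁅ q ⁆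
    }
    where
    open Cover C
    ∣S∣< = ∣p∣<∣p∪⁅x⁆∣ q∉S
    x y : Fin (2 + ∣V∣ G)
    x = suc zero
    y = zero
    x≢y : x ≢ y
    x≢y ()
    G₃ = addEdge (cloneGraph (cloneGraph G p) (suc p′)) x y x≢y
    L′ : V G₃ → Q
    L′ zero          = q
    L′ (suc zero)    = q₂
    -- The old nodes adjacent to the sender's clone are the neighbours of `p`; completeness supplies
    -- their receptions of `m`.
    L′ (suc (suc u)) = if does (E? G p u) then proj₁ (complete (L u) m) else L u
    successful : Successful G₃ x m (L ∘ original p ∘ original (suc p′)) L′
    successful zero          _  = (λ _ → d′) , λ ¬e → ⊥-elim (¬e (inj₂ (inj₁ (refl , refl))))
    successful (suc zero)    ne = ⊥-elim (ne refl)
    successful (suc (suc u)) _ with E? G p u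
    ... | yes e = (λ _ → proj₂ (complete (L u) m)) , λ ¬e → ⊥-elim (¬e (inj₁ e))
    ... | no ¬e = (λ { (inj₁ e) → ⊥-elim (¬e e)
                     ; (inj₂ (inj₁ ()))
                     ; (inj₂ (inj₂ ())) }) , λ _ → refl
    Main′ : Pred (V G₃) 0ℓ
    Main′ zero          = ⊤
    -- The sender's clone is adjacent to the main node `zero`, so it cannot be main.
    Main′ (suc zero)    = ⊥
    Main′ (suc (suc u)) = Main u
    main-original : ∀ u → Main′ u → Main (original p (original (suc p′) u))
    main-original zero          _ = main-p′
    main-original (suc (suc u)) h = h
    nonadj′ : ∀ u v → Main′ u → Main′ v → ¬ E G₃ u v
    nonadj′ u v hu hv (inj₁ e) = nonadj (main-original u hu) (main-original v hv) e
    nonadj′ u v hu hv (inj₂ (inj₁ (refl , _))) = hu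
    nonadj′ u v hu hv (inj₂ (inj₂ (_ , refl))) = hv
    old : ∀ {q′} → q′ ∈ S → ∃[ v ] Main′ v × L′ v ≡ q′
    old q′∈S with cover q′∈S
    ... | v , hv , Lv≡ = suc (suc v) , hv , unchanged
      where
      unchanged : L′ (suc (suc v)) ≡ _
      unchanged with E? G p v
      -- A main node is no neighbour of the main node `p`, so the broadcast does not spoil it.
      ... | yes e = ⊥-elim (nonadj main-p hv e)
      ... | no _  = Lv≡
    new : ∀ {q′} → q′ ∈ ⁅ q ⁆ → ∃[ v ] Main′ v × L′ v ≡ q′
    new q′∈ = zero , tt , sym (x∈⁅y⁆⇒x≡y q q′∈)

  cover-saturation : ∀ {S c S′ c′} → Star _↝_ (S , c) (S′ , c′) → Cover S → Cover S′
  cover-saturation ε                      C = C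
  cover-saturation (broadcast adds ◅ ss)   C = cover-saturation ss (cover-broadcast C adds)
  cover-saturation (reception _ adds ◅ ss) C = cover-saturation ss (cover-reception C adds)

  -- From runs to lossy executions.

  lengthOf : ∀ {γ γ′} → Star _⟶_ γ γ′ → ℕ
  lengthOf = fold (λ _ _ → ℕ) (λ _ n → suc n) 0

  -- A `Run` grows at its end and a `Star` at its front, so the steps already converted are carried
  -- along in `ss`.
  toStar : ∀ {G Quiet L₀ L γ} (r : Run G Quiet L₀ L) (ss : Star _⟶_ (G , L) γ) →
           Σ (Star _⟶_ (G , L₀) γ) λ ss′ → lengthOf ss′ ≡ len r + lengthOf ss
  toStar []                 ss = ss , refl
  toStar (snoc r v m d how) ss with toStar r (step v m d (map₂ proj₂ how) ◅ ss)
  ... | ss′ , eq = ss′ , trans eq (+-suc _ _)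

theorem3p5 : (P : Protocol) (F S : Subset (Protocol.∣Q∣ P)) →
    Saturation.Returns P S →
    Nonempty (F ∩ S) →
    Σ (Lossy.Execution P) λ ρ →
    Lossy.Covers P ρ F ×
    Lossy.Execution.nodes ρ ≤ 2 * Protocol.∣Q∣ P ×
    Lossy.Execution.length ρ ≤ 2 * Protocol.∣Q∣ P ^ 2
theorem3p5 P F S (_ , saturates , _) (q , q∈F∩S)
  with x∈p∩q⁻ F S q∈F∩S | cover-saturation P saturates (cover-I P)
... | q∈F , q∈S | C
  with Cover.cover C q∈S | toStar P (proj₁ (Cover.run C)) ε
... | v , _ , Lv≡q | ss , length≡ =
  record { initial = initial ; steps = ss } ,
  (v , subst (_∈ F) (sym Lv≡q) q∈F) ,
  nodes≤ ,
  length≤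
  where
  open Protocol P
  open Cover C
  nodes≤ : ∣V∣ G ≤ 2 * ∣Q∣
  nodes≤ = ≤-trans nodes (*-monoʳ-≤ 2 (∣p∣≤n S))
  open ≤-Reasoning
  length≤ : lengthOf P ss ≤ 2 * ∣Q∣ ^ 2
  length≤ = begin
    lengthOf P ss               ≡⟨ length≡ ⟩
    len P (proj₁ run) + 0       ≡⟨ +-identityʳ _ ⟩
    len P (proj₁ run)           ≤⟨ proj₁ (proj₂ run) ⟩
    ∣V∣ G * ∣ S ∣               ≤⟨ *-mono-≤ nodes≤ (∣p∣≤n S) ⟩
    2 * ∣Q∣ * ∣Q∣               ≡⟨ *-assoc 2 ∣Q∣ ∣Q∣ ⟩
    2 * (∣Q∣ * ∣Q∣)             ≡⟨ cong (λ k → 2 * (∣Q∣ * k)) (*-identityʳ ∣Q∣) ⟨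
    2 * ∣Q∣ ^ 2                 ∎
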